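{- There exists a sentence $\Gamma$ of the two-variable fragment $\mathbf{FO}^2$ of first-order logic such that for every $n\ge 1$ and every domain $\Delta$ with $|\Delta|=n$, every DNNF circuit encoding the grounding of $(\Gamma,\Delta)$ has size $2^{\Omega(n)}$. (Here $2^{\Omega(n)}$ is the usual asymptotic notation: there are constants $c>0$ and $n_0$, independent of $n$, of $\Delta$ and of the circuit, such that the size is at least $2^{cn}$ whenever $n\ge n_0$.)
   Context: First-order logic here is function-free and constant-free, and it is interpreted over finite domains. Atoms are of the form $P(t_1,\dots,t_k)$ with $P$ a $k$-ary predicate symbol from a finite vocabulary. $\mathbf{FO}^2$ is the set of first-order sentences using at most two distinct variables. Given a sentence $\Gamma$ and a finite domain $\Delta$, the grounding of $(\Gamma,\Delta)$ is the propositional formula obtained by instantiating all quantifiers in $\Gamma$ over the elements of $\Delta$ (universal quantifiers become conjunctions, existential quantifiers become disjunctions). Its propositional variables are the ground atoms $P(a_1,\dots,a_k)$ with $a_1,\dots,a_k\in\Delta$. An NNF circuit $C$ is a node-labelled directed acyclic graph whose internal nodes are labelled by $\wedge$ or $\vee$, whose leaves are labelled by literals (Boolean variables or their negations), and which has a unique output node. It is evaluated bottom-up under truth assignments. $\mathrm{var}(C)$ is the set of variables occurring in $C$, and the size $|C|$ is the number of edges. $C$ is a DNNF (decomposable) if for every $\wedge$-node with children $C_1,\dots,C_r$ (identified with the subcircuits rooted at them), the sets $\mathrm{var}(C_i)$ are pairwise disjoint. $C$ encodes a propositional formula if the two have the same satisfying assignments. -}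

module Defs where

open import Data.Bool.Base using (Bool; T; not)
open import Data.Empty using (⊥-elim)
open import Data.Fin.Base using (Fin)
open import Data.Fin.Properties using (_≟_)
open import Data.Fin.Subset using (Subset; ⊥; ⁅_⁆; _∪_; _∈_; ∣_∣)
open import Data.Fin.Subset.Properties using (∉⊥; x∈p∪q⁻; x∈⁅y⁆⇒x≡y)
open import Data.Nat.Base using (ℕ)
open import Data.Product.Base using (∃; _×_; _,_)
open import Data.Sum.Base using (_⊎_; inj₁; inj₂)
open import Data.Vec.Base using (Vec; map; sum; tabulate)
open import Function.Bundles using (_⇔_; _↔_; Inverse)
open import Relation.Binary.Construct.Closure.ReflexiveTransitive using (Star)
open import Relation.Binary.Construct.Closure.Transitive using (TransClosure)
open import Relation.Binary.PropositionalEquality using (_≡_; _≢_)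
open import Relation.Nullary using (¬_; yes; no)

infix  8 ∼_
infixr 7 _∧_
infixr 6 _∨_

record Vocabulary : Set where
  field
    #predicates : ℕ
    arity       : Fin #predicates → ℕ

open Vocabulary public

-- Formulas whose variables, free or bound, are among k names, and whose free
-- variables lie in S.  Quantifying a variable already in S rebinds it.
data Formula (σ : Vocabulary) {k : ℕ} (S : Subset k) : Set where
  atom    : (P : Fin (#predicates σ)) → Vec (∃ (_∈ S)) (arity σ P) → Formula σ S
  ∼_      : Formula σ S → Formula σ S
  _∧_ _∨_ : Formula σ S → Formula σ S → Formula σ S
  all ex  : (x : Fin k) → Formula σ (S ∪ ⁅ x ⁆) → Formula σ S

FO² : Vocabulary → Set
FO² σ = Formula σ {2} ⊥

record GroundAtom (σ : Vocabulary) (Δ : Set) : Set where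
  constructor _⟨_⟩
  field
    predicate : Fin (#predicates σ)
    arguments : Vec Δ (arity σ predicate)

Assignment : Set → Set
Assignment X = X → Bool

data PropFormula (X : Set) : Set where
  var     : X → PropFormula X
  ∼_      : PropFormula X → PropFormula X
  _∧_ _∨_ : PropFormula X → PropFormula X → PropFormula X
  ⋀ ⋁     : ∀ {n} → (Fin n → PropFormula X) → PropFormula X

infix 4 _⊨_

_⊨_ : ∀ {X} → Assignment X → PropFormula X → Set
α ⊨ var x = T (α x)
α ⊨ ∼ φ   = ¬ (α ⊨ φ)
α ⊨ φ ∧ ψ = (α ⊨ φ) × (α ⊨ ψ)
α ⊨ φ ∨ ψ = (α ⊨ φ) ⊎ (α ⊨ ψ)
α ⊨ ⋀ φs  = ∀ i → α ⊨ φs i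
α ⊨ ⋁ φs  = ∃ λ i → α ⊨ φs i

Env : ∀ {k} → Subset k → Set → Set
Env S Δ = ∀ x → x ∈ S → Δ

extend : ∀ {k} {S : Subset k} {Δ} → Env S Δ → (x : Fin k) → Δ → Env (S ∪ ⁅ x ⁆) Δ
extend {S = S} ρ x d y y∈ with y ≟ x
... | yes _  = d
... | no y≢x with x∈p∪q⁻ S ⁅ x ⁆ y∈
...   | inj₁ y∈S = ρ y y∈S
...   | inj₂ y∈x = ⊥-elim (y≢x (x∈⁅y⁆⇒x≡y x y∈x))

instantiate : ∀ {σ k n} {S : Subset k} {Δ} → Fin n ↔ Δ →
              Formula σ S → Env S Δ → PropFormula (GroundAtom σ Δ)
instantiate Δ-fin (atom P ts) ρ = var (P ⟨ map (λ (x , x∈S) → ρ x x∈S) ts ⟩)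
instantiate Δ-fin (∼ φ)       ρ = ∼ instantiate Δ-fin φ ρ
instantiate Δ-fin (φ ∧ ψ)     ρ = instantiate Δ-fin φ ρ ∧ instantiate Δ-fin ψ ρ
instantiate Δ-fin (φ ∨ ψ)     ρ = instantiate Δ-fin φ ρ ∨ instantiate Δ-fin ψ ρ
instantiate Δ-fin (all x φ)   ρ =
  ⋀ λ i → instantiate Δ-fin φ (extend ρ x (Inverse.to Δ-fin i))
instantiate Δ-fin (ex x φ)    ρ =
  ⋁ λ i → instantiate Δ-fin φ (extend ρ x (Inverse.to Δ-fin i))

grounding : ∀ {σ n Δ} → FO² σ → Fin n ↔ Δ → PropFormula (GroundAtom σ Δ)
grounding Γ Δ-fin = instantiate Δ-fin Γ λ _ x∈⊥ → ⊥-elim (∉⊥ x∈⊥)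

data Literal (X : Set) : Set where
  pos neg : X → Literal X

litVar : ∀ {X} → Literal X → X
litVar (pos x) = x
litVar (neg x) = x

litTrue : ∀ {X} → Assignment X → Literal X → Set
litTrue α (pos x) = T (α x)
litTrue α (neg x) = T (not (α x))

-- A gate carries the set of its children.  This set may be empty, so that the
-- constants are available (∧-gate ⊥ is true, ∨-gate ⊥ is false).  A DNNF without
-- constants is always satisfiable, so excluding them would make every lower
-- bound for an unsatisfiable formula vacuous.
data Label (X : Set) (m : ℕ) : Set where
  literal       : Literal X → Label X m
  ∧-gate ∨-gate : Subset m → Label X m

childrenOf : ∀ {X m} → Label X m → Subset m
childrenOf (literal _) = ⊥
childrenOf (∧-gate cs) = cs
childrenOf (∨-gate cs) = cs

record NNF (X : Set) : Set where
  field
    #nodes : ℕ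
    label  : Fin #nodes → Label X #nodes

  Node : Set
  Node = Fin #nodes

  children : Node → Subset #nodes
  children v = childrenOf (label v)

  Edge : Node → Node → Set
  Edge v u = u ∈ children v

  field
    acyclic       : ∀ v → ¬ TransClosure Edge v v
    output        : Node
    unique-output : ∀ v → (∀ u → ¬ Edge u v) ⇔ v ≡ output

  size : ℕ
  size = sum (tabulate λ v → ∣ children v ∣)

  -- x ∈var v : the variable x occurs in the subcircuit rooted at v.
  _∈var_ : X → Node → Set
  x ∈var v = ∃ λ u → Star Edge v u × ∃ λ l → label u ≡ literal l × litVar l ≡ x

  -- The nodes that evaluate to true under α.  Gates are monotone in their
  -- children and the circuit is acyclic, so the nodes not derivable here are
  -- exactly those that bottom-up evaluation makes false.
  data True (α : Assignment X) (v : Node) : Set where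
    literal : ∀ {l} → label v ≡ literal l → litTrue α l → True α v
    ∧-gate  : ∀ {cs} → label v ≡ ∧-gate cs → (∀ u → u ∈ cs → True α u) → True α v
    ∨-gate  : ∀ {cs} → label v ≡ ∨-gate cs → ∀ u → u ∈ cs → True α u → True α v

  Satisfies : Assignment X → Set
  Satisfies α = True α output

  Decomposable : Set
  Decomposable = ∀ {v cs} → label v ≡ ∧-gate cs →
                 ∀ {u w} → u ∈ cs → w ∈ cs → u ≢ w →
                 ∀ x → ¬ (x ∈var u × x ∈var w)

record DNNF (X : Set) : Set where
  field
    circuit      : NNF X
    decomposable : NNF.Decomposable circuit

  open NNF circuit public

_Encodes_ : ∀ {X} → DNNF X → PropFormula X → Set
C Encodes φ = ∀ α → DNNF.Satisfies C α ⇔ (α ⊨ φ)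

{-# OPTIONS --safe #-}
module Submission where

-- Γ says that no row and no column of a binary relation R is empty.  The
-- minimal models of its grounding are the permutation matrices.  A derivation
-- showing that the circuit accepts the matrix of π reads every entry of π
-- through a positive literal, and somewhere below the output it passes an
-- ∧-gate some of whose children together read a set J of columns with
-- n/3 ≤ |J| ≤ 2n/3.  If ρ passes the same gate, decomposability allows the
-- subderivations of π and ρ below these children to be exchanged; the
-- exchanged assignments are models again, which forces J and π⁻¹(J) to be the
-- same for ρ.  Hence at most |J|! (n ∸ |J|)! ≤ n! / 2^(n/3) permutations share
-- a gate, and there are at least 2^(n/3) gates.

open import Defs
open import Data.Bool.Base as Bool using (Bool; true; false; T; not; if_then_else_)
open import Data.Bool.Properties using (T-≡; T-∧) renaming (_≟_ to _≟ᵇ_)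
open import Data.Empty using (⊥-elim)
open import Data.Fin.Base using (Fin; zero; suc; punchIn)
open import Data.Fin.Permutation using (Permutation′; insert; insert-punchIn; inverseˡ; inverseʳ; _⟨$⟩ʳ_; _⟨$⟩ˡ_) renaming (id to idₚ)
open import Data.Fin.Properties using (_≟_; all?; sequence)
open import Data.Fin.Subset using (Subset; inside; outside; ⊥; ⊤; ⁅_⁆; _∪_; _∈_; _∉_; ∣_∣; ∁)
open import Data.Fin.Subset.Properties
open import Data.Nat.Base
open import Data.Nat.DivMod using (m/n*n≤m; m≡m%n+[m/n]*n; m%n<n; /-mono-≤)
open import Data.Nat.Properties hiding (_≟_)
open import Data.Product.Base using (∃; ∃₂; _×_; _,_; proj₁; proj₂)
open import Data.Sum.Base using (_⊎_; inj₁; inj₂; [_,_])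
open import Data.Vec.Base as Vec using (_∷_; []; lookup; removeAt; here; there; tabulate)
open import Data.Vec.Properties using (lookup⇒[]=; []=⇒lookup; lookup∘tabulate)
open import Data.Vec.Properties.WithK using ([]=-irrelevant)
open import Effect.Monad using (RawMonad)
open import Function.Base using (_∘_; id)
open import Function.Bundles using (_↔_; Equivalence; Inverse)
open import Relation.Binary.Construct.Closure.ReflexiveTransitive using (ε; _◅_)
open import Relation.Binary.PropositionalEquality using (_≡_; _≢_; refl; sym; trans; cong; cong₂; subst; subst₂; module ≡-Reasoning)
open import Relation.Nullary using (¬_; Dec; yes; no; does; isYes; contradiction; decidable-stable; ¬¬-excluded-middle; toWitness; fromWitness)
open import Relation.Nullary.Decidable using (dec-true; dec-false)
open import Relation.Nullary.Negation using (¬¬-Monad)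
open import Algebra.Properties.CommutativeMonoid.Sum +-0-commutativeMonoid using (sum; ∑-comm)

-- Finite sums and averaging.

sum-mono-≤ : ∀ {n} {f g : Fin n → ℕ} → (∀ i → f i ≤ g i) → sum f ≤ sum g
sum-mono-≤ {zero}  f≤g = z≤n
sum-mono-≤ {suc n} f≤g = +-mono-≤ (f≤g zero) (sum-mono-≤ (f≤g ∘ suc))

sum≤* : ∀ {n c} {f : Fin n → ℕ} → (∀ i → f i ≤ c) → sum f ≤ n * c
sum≤* {zero}  f≤c = z≤n
sum≤* {suc n} f≤c = +-mono-≤ (f≤c zero) (sum≤* (f≤c ∘ suc))

sum-*ʳ : ∀ {n} (f : Fin n → ℕ) c → sum (λ i → f i * c) ≡ sum f * c
sum-*ʳ {zero}  f c = refl
sum-*ʳ {suc n} f c = trans (cong (f zero * c +_) (sum-*ʳ (f ∘ suc) c)) (sym (*-distribʳ-+ c (f zero) _))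

term≤sum : ∀ {n} (f : Fin n → ℕ) i → f i ≤ sum f
term≤sum f zero    = m≤m+n (f zero) _
term≤sum f (suc i) = m≤n⇒m≤o+n (f zero) (term≤sum (f ∘ suc) i)

sum<*⇒∃< : ∀ {n c} (f : Fin n → ℕ) → sum f < n * c → ∃ λ i → f i < c
sum<*⇒∃< {suc n} {c} f f<nc with f zero <? c
... | yes f₀<c = zero , f₀<c
... | no  f₀≮c with sum<*⇒∃< (f ∘ suc)
      (+-cancelˡ-< c _ _ (≤-<-trans (+-monoˡ-≤ _ (≮⇒≥ f₀≮c)) f<nc))
...   | i , fᵢ<c = suc i , fᵢ<c

sum-over-subset : ∀ {n c} (p : Subset n) {f : Fin n → ℕ} →
  (∀ i → lookup p i ≡ true → f i ≤ c) → (∀ i → lookup p i ≡ false → f i ≡ 0) →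
  sum f ≤ ∣ p ∣ * c
sum-over-subset []          _  _  = z≤n
sum-over-subset (true ∷ p)  f≤ f≡ = +-mono-≤ (f≤ zero refl) (sum-over-subset p (f≤ ∘ suc) (f≡ ∘ suc))
sum-over-subset (false ∷ p) f≤ f≡ rewrite f≡ zero refl = sum-over-subset p (f≤ ∘ suc) (f≡ ∘ suc)

-- Counting permutations and the union bound.

Event : ℕ → Set
Event n = Permutation′ n → Bool

-- Recursion on the image `y` of `zero`. Each permutation is tested through one representative, the
-- one assembled by `insert`, so permutations never have to be enumerated or compared for equality.
count : ∀ {n} → Event n → ℕ
count {zero}  E = if E idₚ then 1 else 0
count {suc n} E = sum λ y → count (E ∘ insert zero y)

count-mono : ∀ {n} {E F : Event n} → (∀ π → E π ≡ true → F π ≡ true) → count E ≤ count F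
count-mono {zero} {E} {F} E⊆F with E idₚ in eq
... | false = z≤n
... | true rewrite E⊆F idₚ eq = ≤-refl
count-mono {suc n} E⊆F = sum-mono-≤ λ y → count-mono (E⊆F ∘ insert zero y)

count-∅ : ∀ {n} {E : Event n} → (∀ π → E π ≡ false) → count E ≡ 0
count-∅ {zero}  E≡∅ rewrite E≡∅ idₚ = refl
count-∅ {suc n} {E} E≡∅ = n≤0⇒n≡0 (subst (count E ≤_) (*-zeroʳ (suc n))
  (sum≤* λ y → ≤-reflexive (count-∅ (E≡∅ ∘ insert zero y))))

-- The union bound, made constructive by the method of conditional expectations: after exchanging
-- the two sums, some image `y` of `zero` leaves a total below `n !`, and the recursion fixes the
-- remaining values. At the end the total is below 1, so every event fails.
avoid : ∀ {m n} (E : Fin m → Event n) → sum (count ∘ E) < n ! → ∃ λ π → ∀ v → E v π ≡ false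
avoid {n = zero} E small = idₚ , λ v → excluded v (n<1⇒n≡0 (≤-<-trans (term≤sum (count ∘ E) v) small))
  where
  excluded : ∀ v → count (E v) ≡ 0 → E v idₚ ≡ false
  excluded v _ with E v idₚ
  excluded v _  | false = refl
  excluded v () | true
avoid {n = suc n} E small
  with y , small′ ← sum<*⇒∃< (λ y → sum λ v → count (E v ∘ insert zero y))
         (subst (_< suc n !) (∑-comm λ v y → count (E v ∘ insert zero y)) small)
  with π , avoids ← avoid (λ v → E v ∘ insert zero y) small′
  = insert zero y π , avoids

-- Permutations under which a set has a prescribed preimage.

lookup-removeAt : ∀ {n} (J : Subset (suc n)) y x → lookup (removeAt J y) x ≡ lookup J (punchIn y x)
lookup-removeAt (b ∷ J)          zero    x       = refl
lookup-removeAt (b ∷ J@(_ ∷ _)) (suc y) zero    = refl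
lookup-removeAt (b ∷ J@(_ ∷ _)) (suc y) (suc x) = lookup-removeAt J y x

∣removeAt∣-inside : ∀ {n} (J : Subset (suc n)) y → lookup J y ≡ true → ∣ J ∣ ≡ suc ∣ removeAt J y ∣
∣removeAt∣-inside (true ∷ J)              zero    _ = refl
∣removeAt∣-inside (true ∷ J@(_ ∷ _))  (suc y) y∈J = cong suc (∣removeAt∣-inside J y y∈J)
∣removeAt∣-inside (false ∷ J@(_ ∷ _)) (suc y) y∈J = ∣removeAt∣-inside J y y∈J

∣removeAt∣-outside : ∀ {n} (J : Subset (suc n)) y → lookup J y ≡ false → ∣ J ∣ ≡ ∣ removeAt J y ∣
∣removeAt∣-outside (false ∷ J)             zero    _ = refl
∣removeAt∣-outside (true ∷ J@(_ ∷ _))  (suc y) y∉J = cong suc (∣removeAt∣-outside J y y∉J)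
∣removeAt∣-outside (false ∷ J@(_ ∷ _)) (suc y) y∉J = ∣removeAt∣-outside J y y∉J

∁-removeAt : ∀ {n} (J : Subset (suc n)) y → ∁ (removeAt J y) ≡ removeAt (∁ J) y
∁-removeAt (b ∷ J)          zero    = refl
∁-removeAt (b ∷ J@(_ ∷ _)) (suc y) = cong (not b ∷_) (∁-removeAt J y)

lookup-∁ : ∀ {n} (J : Subset n) y → lookup (∁ J) y ≡ not (lookup J y)
lookup-∁ (b ∷ J) zero    = refl
lookup-∁ (b ∷ J) (suc y) = lookup-∁ J y

Preimage : ∀ {n} → Subset n → Subset n → Permutation′ n → Set
Preimage I J π = ∀ x → lookup I x ≡ lookup J (π ⟨$⟩ʳ x)

preimage? : ∀ {n} (I J : Subset n) π → Dec (Preimage I J π)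
preimage? I J π = all? λ x → lookup I x ≟ᵇ lookup J (π ⟨$⟩ʳ x)

preimage : ∀ {n} → Subset n → Subset n → Event n
preimage I J π = does (preimage? I J π)

does⁻ : ∀ {A : Set} (A? : Dec A) → does A? ≡ true → A
does⁻ (yes a) _ = a

-- The number of permutations that carry a fixed set of size `∣ J ∣` onto `J`.
weight : ∀ {n} → Subset n → ℕ
weight J = ∣ J ∣ ! * ∣ ∁ J ∣ !

preimage-tail : ∀ {n b} (I : Subset n) J y π →
  Preimage (b ∷ I) J (insert zero y π) → Preimage I (removeAt J y) π
preimage-tail I J y π pre x = begin
  lookup I x                                  ≡⟨ pre (suc x) ⟩
  lookup J (insert zero y π ⟨$⟩ʳ suc x)       ≡⟨ cong (lookup J) (insert-punchIn zero y π x) ⟩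
  lookup J (punchIn y (π ⟨$⟩ʳ x))             ≡⟨ lookup-removeAt J y _ ⟨
  lookup (removeAt J y) (π ⟨$⟩ʳ x)            ∎
  where open ≡-Reasoning

-- Only an inequality because of `k = 0`, where the left side is 0 and the right side is `c`.
suc-pred-! : ∀ k c → k * (pred k ! * c) ≤ k ! * c
suc-pred-! zero    c = z≤n
suc-pred-! (suc k) c = ≤-reflexive (sym (*-assoc (suc k) (k !) c))

-- A point of `I` has `∣ J ∣` possible images and a point outside `I` has `∣ ∁ J ∣`. Either choice
-- removes one element from its side, and the factor completes the corresponding factorial.
count-preimage : ∀ {n} (I J : Subset n) → count (preimage I J) ≤ weight J
count-preimage []      []  = ≤-refl
count-preimage (b ∷ I) J = bound b refl
  where
  open ≤-Reasoning
  tail : ∀ {y} → count (preimage (b ∷ I) J ∘ insert zero y) ≤ weight (removeAt J y)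
  tail {y} = ≤-trans
    (count-mono λ π pre → dec-true (preimage? I (removeAt J y) π)
      (preimage-tail I J y π (does⁻ (preimage? (b ∷ I) J (insert zero y π)) pre)))
    (count-preimage I (removeAt J y))

  none : ∀ {y} → b ≢ lookup J y → count (preimage (b ∷ I) J ∘ insert zero y) ≡ 0
  none {y} b≢Jy = count-∅ λ π → dec-false (preimage? (b ∷ I) J (insert zero y π)) λ pre → b≢Jy (pre zero)

  bound : ∀ c → b ≡ c → count (preimage (b ∷ I) J) ≤ weight J
  bound true refl = begin
    count (preimage (true ∷ I) J)
      ≤⟨ sum-over-subset J
           (λ y y∈J → ≤-trans tail (≤-reflexive (cong₂ (λ k l → k ! * l !)
             (cong pred (sym (∣removeAt∣-inside J y y∈J)))
             (trans (cong ∣_∣ (∁-removeAt J y))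
                    (sym (∣removeAt∣-outside (∁ J) y (trans (lookup-∁ J y) (cong not y∈J))))))))
           (λ y y∉J → none λ eq → contradiction (trans eq y∉J) λ ()) ⟩
    ∣ J ∣ * (pred ∣ J ∣ ! * ∣ ∁ J ∣ !)
      ≤⟨ suc-pred-! ∣ J ∣ _ ⟩
    weight J ∎
  bound false refl = begin
    count (preimage (false ∷ I) J)
      ≤⟨ sum-over-subset (∁ J)
           (λ y y∈∁J → ≤-trans tail (≤-reflexive (trans
             (*-comm (∣ removeAt J y ∣ !) _)
             (cong₂ (λ k l → k ! * l !)
               (trans (cong ∣_∣ (∁-removeAt J y)) (cong pred (sym (∣removeAt∣-inside (∁ J) y y∈∁J))))
               (sym (∣removeAt∣-outside J y (not-injective′ (trans (sym (lookup-∁ J y)) y∈∁J))))))))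
           (λ y y∉∁J → none λ eq → contradiction
             (trans (sym y∉∁J) (trans (lookup-∁ J y) (cong not (sym eq)))) λ ()) ⟩
    ∣ ∁ J ∣ * (pred ∣ ∁ J ∣ ! * ∣ J ∣ !)
      ≤⟨ suc-pred-! ∣ ∁ J ∣ _ ⟩
    ∣ ∁ J ∣ ! * ∣ J ∣ !
      ≡⟨ *-comm (∣ ∁ J ∣ !) _ ⟩
    weight J ∎
    where
    not-injective′ : ∀ {c} → not c ≡ true → c ≡ false
    not-injective′ {false} _ = refl

-- Raising `a` by one multiplies the left side by 2(a+1) and the right side by a+1+b, which is at
-- least as large because a+1 ≤ b.
2^a*a!*b!≤[a+b]! : ∀ {a b} → a ≤ b → 2 ^ a * (a ! * b !) ≤ (a + b) !
2^a*a!*b!≤[a+b]! {zero} {b} _ = ≤-reflexive (trans (*-identityˡ _) (*-identityˡ _))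
2^a*a!*b!≤[a+b]! {suc a} {b} a<b = begin
  2 * 2 ^ a * (suc a * a ! * b !)    ≡⟨ cong (2 * 2 ^ a *_) (*-assoc (suc a) (a !) (b !)) ⟩
  2 * 2 ^ a * (suc a * (a ! * b !))  ≡⟨ [m*n]*[o*p]≡[m*o]*[n*p] 2 (2 ^ a) (suc a) _ ⟩
  2 * suc a * (2 ^ a * (a ! * b !))  ≤⟨ *-mono-≤ 2[1+a]≤ (2^a*a!*b!≤[a+b]! (<⇒≤ a<b)) ⟩
  suc (a + b) * (a + b) !            ∎
  where
  open ≤-Reasoning
  2[1+a]≤ : 2 * suc a ≤ suc (a + b)
  2[1+a]≤ = +-monoʳ-≤ (suc a) (subst (_≤ b) (sym (+-identityʳ (suc a))) a<b)

-- Says that the binomial coefficient of `n` over `∣ J ∣` is at least 2^t. The smaller of `J` and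
-- `∁ J` still has at least `t` elements and plays the role of `a` in the previous bound.
2^t*weight≤n! : ∀ {n t} (J : Subset n) → t ≤ ∣ J ∣ → ∣ J ∣ + t ≤ n → 2 ^ t * weight J ≤ n !
2^t*weight≤n! {n} {t} J t≤J J+t≤n = subst (λ k → 2 ^ t * weight J ≤ k !) J+∁J≡n bound
  where
  J+∁J≡n : ∣ J ∣ + ∣ ∁ J ∣ ≡ n
  J+∁J≡n = trans (cong (∣ J ∣ +_) (∣∁p∣≡n∸∣p∣ J)) (m+[n∸m]≡n (∣p∣≤n J))
  t≤∁J : t ≤ ∣ ∁ J ∣
  t≤∁J = +-cancelˡ-≤ ∣ J ∣ _ _ (subst (∣ J ∣ + t ≤_) (sym J+∁J≡n) J+t≤n)
  bound : 2 ^ t * weight J ≤ (∣ J ∣ + ∣ ∁ J ∣) !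
  bound with ≤-total ∣ J ∣ ∣ ∁ J ∣
  ... | inj₁ J≤∁J = ≤-trans (*-monoˡ-≤ (weight J) (^-monoʳ-≤ 2 t≤J)) (2^a*a!*b!≤[a+b]! J≤∁J)
  ... | inj₂ ∁J≤J = subst₂ (λ u k → 2 ^ t * u ≤ k !) (*-comm (∣ ∁ J ∣ !) _) (+-comm ∣ ∁ J ∣ _)
    (≤-trans (*-monoˡ-≤ _ (^-monoʳ-≤ 2 t≤∁J)) (2^a*a!*b!≤[a+b]! ∁J≤J))

-- Unions of families of subsets.

-- The family takes the membership proof as an argument because the subderivations at an ∧-gate are
-- indexed by such proofs.
⋃[_] : ∀ {m n} (S : Subset m) → (∀ u → u ∈ S → Subset n) → Subset n
⋃[ [] ]          f = ⊥
⋃[ inside ∷ S ]  f = f zero here ∪ ⋃[ S ] (λ u u∈S → f (suc u) (there u∈S))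
⋃[ outside ∷ S ] f = ⋃[ S ] (λ u u∈S → f (suc u) (there u∈S))

module _ {n : ℕ} where

  ∈⋃⁺ : ∀ {m} {S : Subset m} (f : ∀ u → u ∈ S → Subset n) {y} u u∈S → y ∈ f u u∈S → y ∈ ⋃[ S ] f
  ∈⋃⁺ {S = inside ∷ S}  f zero    here        y∈ = x∈p∪q⁺ (inj₁ y∈)
  ∈⋃⁺ {S = inside ∷ S}  f (suc u) (there u∈S) y∈ = x∈p∪q⁺ (inj₂ (∈⋃⁺ _ u u∈S y∈))
  ∈⋃⁺ {S = outside ∷ S} f (suc u) (there u∈S) y∈ = ∈⋃⁺ _ u u∈S y∈

  ∈⋃⁻ : ∀ {m} {S : Subset m} (f : ∀ u → u ∈ S → Subset n) {y} → y ∈ ⋃[ S ] f →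
        ∃₂ λ u u∈S → y ∈ f u u∈S
  ∈⋃⁻ {S = []}          f y∈ = contradiction y∈ ∉⊥
  ∈⋃⁻ {S = outside ∷ S} f y∈ with u , u∈S , y∈fu ← ∈⋃⁻ _ y∈ = suc u , there u∈S , y∈fu
  ∈⋃⁻ {S = inside ∷ S}  f y∈ with x∈p∪q⁻ (f zero here) _ y∈
  ... | inj₁ y∈f₀ = zero , here , y∈f₀
  ... | inj₂ y∈⋃ with u , u∈S , y∈fu ← ∈⋃⁻ _ y∈⋃ = suc u , there u∈S , y∈fu

  ⋃[⊥] : ∀ {m} (f : ∀ u → u ∈ ⊥ {m} → Subset n) → ⋃[ ⊥ ] f ≡ ⊥
  ⋃[⊥] {zero}  f = refl
  ⋃[⊥] {suc m} f = ⋃[⊥] {m} _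

  Balanced : ℕ → Subset n → Set
  Balanced t J = t ≤ ∣ J ∣ × ∣ J ∣ + t ≤ n

∣p∪q∣≤∣p∣+∣q∣ : ∀ {n} (p q : Subset n) → ∣ p ∪ q ∣ ≤ ∣ p ∣ + ∣ q ∣
∣p∪q∣≤∣p∣+∣q∣ []            []            = z≤n
∣p∪q∣≤∣p∣+∣q∣ (outside ∷ p) (outside ∷ q) = ∣p∪q∣≤∣p∣+∣q∣ p q
∣p∪q∣≤∣p∣+∣q∣ (outside ∷ p) (inside ∷ q)  =
  ≤-trans (s≤s (∣p∪q∣≤∣p∣+∣q∣ p q)) (≤-reflexive (sym (+-suc ∣ p ∣ ∣ q ∣)))
∣p∪q∣≤∣p∣+∣q∣ (inside ∷ p)  (b ∷ q)       =
  s≤s (≤-trans (∣p∪q∣≤∣p∣+∣q∣ p q) (+-monoʳ-≤ ∣ p ∣ (∣p∣≤∣x∷p∣ b q)))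

∣⋃[⊤]∣≤sum : ∀ {m n} (f : Fin m → Subset n) → ∣ ⋃[ ⊤ ] (λ u _ → f u) ∣ ≤ Vec.sum (tabulate λ u → ∣ f u ∣)
∣⋃[⊤]∣≤sum {zero}  {n} f = ≤-reflexive (∣⊥∣≡0 n)
∣⋃[⊤]∣≤sum {suc m} f = ≤-trans (∣p∪q∣≤∣p∣+∣q∣ (f zero) _) (+-monoʳ-≤ ∣ f zero ∣ (∣⋃[⊤]∣≤sum (f ∘ suc)))

-- Drop members of S one by one: either the size of the union enters [t , n ∸ t]
-- on the way down, or a single member accounts for a drop of at least t.
split : ∀ {m n t} (S : Subset m) (f : ∀ u → u ∈ S → Subset n) → t + t + t ≤ n →
  n < ∣ ⋃[ S ] f ∣ + t →
  (∃₂ λ S′ (S′⊆S : ∀ u → u ∈ S′ → u ∈ S) → Balanced t (⋃[ S′ ] λ u u∈S′ → f u (S′⊆S u u∈S′)))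
  ⊎ (∃₂ λ u u∈S → n < ∣ f u u∈S ∣ + t)
split {n = n} {t} [] f 3t≤n big = contradiction
  (subst (λ k → n < k + t) (∣⊥∣≡0 n) big)
  (≤⇒≯ (≤-trans (m≤n+m t (t + t)) 3t≤n))
split (outside ∷ S) f 3t≤n big with split S (λ u u∈S → f (suc u) (there u∈S)) 3t≤n big
... | inj₁ (S′ , S′⊆S , bal) =
  inj₁ (outside ∷ S′ , (λ { (suc u) (there u∈S′) → there (S′⊆S u u∈S′) }) , bal)
... | inj₂ (u , u∈S , large) = inj₂ (suc u , there u∈S , large)
split {m} {n} {t} (inside ∷ S) f 3t≤n big
  with ∣ ⋃[ S ] (λ u u∈S → f (suc u) (there u∈S)) ∣ + t ≤? n
... | no B≰ with split S (λ u u∈S → f (suc u) (there u∈S)) 3t≤n (≰⇒> B≰)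
...   | inj₁ (S′ , S′⊆S , bal) =
  inj₁ (outside ∷ S′ , (λ { (suc u) (there u∈S′) → there (S′⊆S u u∈S′) }) , bal)
...   | inj₂ (u , u∈S , large) = inj₂ (suc u , there u∈S , large)
split {m} {n} {t} (inside ∷ S) f 3t≤n big | yes B≤
  with t ≤? ∣ ⋃[ S ] (λ u u∈S → f (suc u) (there u∈S)) ∣
... | yes t≤B = inj₁ (outside ∷ S , (λ { (suc u) (there u∈S) → there u∈S }) , t≤B , B≤)
... | no t≰B with ∣ f zero here ∣ + t ≤? n
...   | no A≰  = inj₂ (zero , here , ≰⇒> A≰)
...   | yes A≤ = inj₁ (inside ∷ ⊥ , ⊥⊆S , subst (Balanced t) (sym A∪⊥) (t≤A , A≤))
  where
  B : Subset n
  B = ⋃[ S ] (λ u u∈S → f (suc u) (there u∈S))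
  ⊥⊆S : ∀ u → u ∈ inside ∷ ⊥ → u ∈ inside ∷ S
  ⊥⊆S zero    here       = here
  ⊥⊆S (suc u) (there u∈) = contradiction u∈ ∉⊥
  A∪⊥ : ⋃[ inside ∷ ⊥ ] (λ u u∈ → f u (⊥⊆S u u∈)) ≡ f zero here
  A∪⊥ = trans (cong (f zero here ∪_) (⋃[⊥] λ u u∈ → f (suc u) (⊥⊆S (suc u) (there u∈)))) (∪-identityʳ (f zero here))
  t≤A : t ≤ ∣ f zero here ∣
  t≤A = +-cancelʳ-≤ (t + t) _ _ (begin
    t + (t + t)                        ≡⟨ +-assoc t t t ⟨
    t + t + t                          ≤⟨ 3t≤n ⟩
    n                                  ≤⟨ <⇒≤ big ⟩
    ∣ f zero here ∪ B ∣ + t            ≤⟨ +-monoˡ-≤ t (∣p∪q∣≤∣p∣+∣q∣ (f zero here) B) ⟩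
    ∣ f zero here ∣ + ∣ B ∣ + t        ≤⟨ +-monoˡ-≤ t (+-monoʳ-≤ _ (≰⇒≥ t≰B)) ⟩
    ∣ f zero here ∣ + t + t            ≡⟨ +-assoc ∣ f zero here ∣ t t ⟩
    ∣ f zero here ∣ + (t + t)          ∎)
    where open ≤-Reasoning

-- Derivations in a DNNF, their columns and their contexts.

module Derivations {X : Set} (C : DNNF X) {n : ℕ} (col : X → Fin n) where

  open DNNF C

  private variable
    α α′ β : Assignment X
    v      : Node
    cs S   : Subset #nodes

  -- Negative literals contribute nothing: switching off atoms that are not read positively never
  -- invalidates a derivation.
  cols : True α v → Subset n
  cols (literal {l = pos a} _ _) = ⁅ col a ⁆
  cols (literal {l = neg a} _ _) = ⊥
  cols (∧-gate {cs} _ ds)        = ⋃[ cs ] λ u u∈cs → cols (ds u u∈cs)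
  cols (∨-gate _ _ _ d)          = cols d

  cols∈ : (S : Subset #nodes) → (∀ u → u ∈ S → True α u) → Subset n
  cols∈ S ds = ⋃[ S ] λ u u∈S → cols (ds u u∈S)

  -- Under such an assignment a column stands for the only true atom in it, so recording columns
  -- identifies the atoms read.
  ColumnInjective : Assignment X → Set
  ColumnInjective α = ∀ {a b} → T (α a) → T (α b) → col a ≡ col b → a ≡ b

  child-var : ∀ {a u} → u ∈ childrenOf (label v) → a ∈var u → a ∈var v
  child-var u∈ (w , path , occ) = w , u∈ ◅ path , occ

  ∧-child-var : ∀ {a u} → label v ≡ ∧-gate cs → u ∈ cs → a ∈var u → a ∈var v
  ∧-child-var eq u∈cs = child-var (subst (λ l → _ ∈ childrenOf l) (sym eq) u∈cs)

  ∨-child-var : ∀ {a u} → label v ≡ ∨-gate cs → u ∈ cs → a ∈var u → a ∈var v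
  ∨-child-var eq u∈cs = child-var (subst (λ l → _ ∈ childrenOf l) (sym eq) u∈cs)

  -- The literal that put the column into `cols d` is true under `α`, so injectivity identifies its
  -- atom with `a`.
  cols⇒var : ColumnInjective α → (d : True α v) → ∀ a → T (α a) → col a ∈ cols d → a ∈var v
  cols⇒var inj (literal {l = pos b} eq αb) a αa a∈
    with refl ← inj αa αb (x∈⁅y⁆⇒x≡y (col b) a∈) = _ , ε , _ , eq , refl
  cols⇒var inj (literal {l = neg b} eq _) a αa a∈ = contradiction a∈ ∉⊥
  cols⇒var inj (∧-gate eq ds) a αa a∈ with u , u∈cs , a∈u ← ∈⋃⁻ _ a∈ =
    ∧-child-var eq u∈cs (cols⇒var inj (ds u u∈cs) a αa a∈u)
  cols⇒var inj (∨-gate eq u u∈cs d) a αa a∈ = ∨-child-var eq u∈cs (cols⇒var inj d a αa a∈)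

  -- A derivation relies on the truth of its positive literals, which the first hypothesis
  -- preserves, and on the falsity of its negated atoms, which the second preserves. The same
  -- derivation therefore works for `β`.
  transfer : (d : True α v) → (∀ a → T (α a) → col a ∈ cols d → T (β a)) →
             (∀ a → a ∈var v → T (β a) → T (α a)) → True β v
  transfer (literal {l = pos a} eq αa) up down = literal eq (up a αa (x∈⁅x⁆ (col a)))
  transfer {α = α} {β = β} (literal {l = neg a} eq ¬αa) up down = literal eq ¬βa
    where
    ¬βa : T (not (β a))
    ¬βa with β a in βa
    ... | false = _
    ... | true with α a | down a (_ , ε , _ , eq , refl) (Equivalence.from T-≡ βa)
    ...   | true | _ = ¬αa
  transfer (∧-gate eq ds) up down = ∧-gate eq λ u u∈cs →
    transfer (ds u u∈cs) (λ a αa a∈ → up a αa (∈⋃⁺ _ u u∈cs a∈))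
      (λ a a∈u → down a (∧-child-var eq u∈cs a∈u))
  transfer (∨-gate eq u u∈cs d) up down =
    ∨-gate eq u u∈cs (transfer d up λ a a∈u → down a (∨-child-var eq u∈cs a∈u))

  -- The part of a derivation of the output that lies outside a subcircuit with
  -- variables V; the subcircuit is true under the assignments in B and
  -- accounts for the columns J.
  record Context (α : Assignment X) (J : Subset n) (V : X → Set) (B : Assignment X → Set) : Set where
    field
      fresh : ∀ a → T (α a) → col a ∉ J → ¬ V a
      plug  : ∀ β → (∀ a → T (α a) → col a ∉ J → T (β a)) →
              (∀ a → T (β a) → T (α a) ⊎ V a) → B β → Satisfies β

  open Context

  VarIn : Subset #nodes → X → Set
  VarIn S a = ∃ λ u → u ∈ S × a ∈var u

  TrueOn : Subset #nodes → Assignment X → Set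
  TrueOn S β = ∀ u → u ∈ S → True β u

  NodeContext : True α v → Set
  NodeContext {α} {v} d = Context α (cols d) (_∈var v) (λ β → True β v)

  GateContext : (S : Subset #nodes) → TrueOn S α → Set
  GateContext {α} S ds = Context α (cols∈ S ds) (VarIn S) (TrueOn S)

  -- Narrows the context of a whole gate to the children selected by `Q`; `J`, `V` and `B` are their
  -- columns, their variables and their truth. By decomposability the other children share no
  -- variable with `V`, so their derivations carry over by `transfer`. Keeping these parameters
  -- abstract serves both a single child and a set of children.
  focus : ColumnInjective α → label v ≡ ∧-gate cs → (ds : TrueOn cs α) → GateContext cs ds →
    {Q : Node → Set} → (∀ u → Dec (Q u)) →
    ∀ {J V} {B : Assignment X → Set} →
    (∀ {y} → y ∈ J → ∃₂ λ u u∈cs → Q u × y ∈ cols (ds u u∈cs)) →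
    (∀ {y} u u∈cs → Q u → y ∈ cols (ds u u∈cs) → y ∈ J) →
    (∀ {a} → V a → ∃ λ u → u ∈ cs × Q u × a ∈var u) →
    (∀ {β} → B β → ∀ u → u ∈ cs → Q u → True β u) →
    Context α J V B
  focus {α} {v} {cs} inj eq ds ctx {Q} Q? {J} {V} {B} J⁻ J⁺ V⁻ B⁻ = record
    { fresh = fresh′
    ; plug  = λ β up down Bβ → plug ctx β
        (λ a αa a∉ → up a αa (a∉ ∘ J⊆))
        (λ a βa → [ inj₁ , inj₂ ∘ V⊆ ] (down a βa))
        (rest β up down Bβ)
    }
    where
    J⊆ : ∀ {y} → y ∈ J → y ∈ cols∈ cs ds
    J⊆ y∈J with u , u∈cs , _ , y∈u ← J⁻ y∈J = ∈⋃⁺ _ u u∈cs y∈u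

    V⊆ : ∀ {a} → V a → VarIn cs a
    V⊆ Va with u , u∈cs , _ , a∈u ← V⁻ Va = u , u∈cs , a∈u

    ¬V : ∀ {a u} → u ∈ cs → ¬ Q u → a ∈var u → ¬ V a
    ¬V u∈cs ¬Qu a∈u Va with w , w∈cs , Qw , a∈w ← V⁻ Va =
      decomposable eq u∈cs w∈cs (λ { refl → ¬Qu Qw }) _ (a∈u , a∈w)

    fresh′ : ∀ a → T (α a) → col a ∉ J → ¬ V a
    fresh′ a αa a∉J Va with col a ∈? cols∈ cs ds
    ... | no  a∉ = fresh ctx a αa a∉ (V⊆ Va)
    ... | yes a∈ with u , u∈cs , a∈u ← ∈⋃⁻ _ a∈ =
      ¬V u∈cs (λ Qu → a∉J (J⁺ u u∈cs Qu a∈u)) (cols⇒var inj (ds u u∈cs) a αa a∈u) Va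

    rest : ∀ β → (∀ a → T (α a) → col a ∉ J → T (β a)) → (∀ a → T (β a) → T (α a) ⊎ V a) →
           B β → TrueOn cs β
    rest β up down Bβ u u∈cs with Q? u
    ... | yes Qu = B⁻ Bβ u u∈cs Qu
    ... | no ¬Qu = transfer (ds u u∈cs)
      (λ a αa a∈u → up a αa λ a∈J → not-in-J a αa a∈u (J⁻ a∈J))
      (λ a a∈u βa → [ id , ⊥-elim ∘ ¬V u∈cs ¬Qu a∈u ] (down a βa))
      where
      not-in-J : ∀ a → T (α a) → col a ∈ cols (ds u u∈cs) →
                 ¬ (∃₂ λ w w∈cs → Q w × col a ∈ cols (ds w w∈cs))
      not-in-J a αa a∈u (w , w∈cs , Qw , a∈w) =
        decomposable eq u∈cs w∈cs (λ { refl → ¬Qu Qw }) a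
          (cols⇒var inj (ds u u∈cs) a αa a∈u , cols⇒var inj (ds w w∈cs) a αa a∈w)

  at-child : ColumnInjective α → label v ≡ ∧-gate cs → (ds : TrueOn cs α) → GateContext cs ds →
    ∀ u u∈cs → NodeContext (ds u u∈cs)
  at-child inj eq ds ctx u u∈cs = focus inj eq ds ctx (_≟ u)
    (λ y∈ → u , u∈cs , refl , y∈)
    -- The columns of a subderivation depend on the membership proof that selects it, and two proofs
    -- of the same membership are equal.
    (λ { _ w∈cs refl y∈ → subst (λ p → _ ∈ cols (ds u p)) ([]=-irrelevant w∈cs u∈cs) y∈ })
    (λ a∈u → u , u∈cs , refl , a∈u)
    (λ { βu _ _ refl → βu })

  at-children : ColumnInjective α → label v ≡ ∧-gate cs → (ds : TrueOn cs α) → GateContext cs ds →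
    ∀ S (S⊆cs : ∀ u → u ∈ S → u ∈ cs) → GateContext S (λ u u∈S → ds u (S⊆cs u u∈S))
  at-children inj eq ds ctx S S⊆cs = focus inj eq ds ctx (_∈? S)
    (λ y∈ → let u , u∈S , y∈u = ∈⋃⁻ _ y∈ in u , S⊆cs u u∈S , u∈S , y∈u)
    (λ u u∈cs u∈S y∈ → ∈⋃⁺ _ u u∈S
      (subst (λ p → _ ∈ cols (ds u p)) ([]=-irrelevant u∈cs (S⊆cs u u∈S)) y∈))
    (λ (u , u∈S , a∈u) → u , S⊆cs u u∈S , u∈S , a∈u)
    (λ βS u _ u∈S → βS u u∈S)

  ∧-context : ∀ (eq : label v ≡ ∧-gate cs) (ds : TrueOn cs α) →
    NodeContext (∧-gate eq ds) → GateContext cs ds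
  ∧-context eq ds ctx = record
    { fresh = λ a αa a∉ (u , u∈cs , a∈u) → fresh ctx a αa a∉ (∧-child-var eq u∈cs a∈u)
    ; plug  = λ β up down βcs → plug ctx β up
        (λ a βa → [ inj₁ , (λ (u , u∈cs , a∈u) → inj₂ (∧-child-var eq u∈cs a∈u)) ] (down a βa))
        (∧-gate eq βcs)
    }

  ∨-context : ∀ (eq : label v ≡ ∨-gate cs) u u∈cs (d : True α u) →
    NodeContext (∨-gate eq u u∈cs d) → NodeContext d
  ∨-context eq u u∈cs d ctx = record
    { fresh = λ a αa a∉ a∈u → fresh ctx a αa a∉ (∨-child-var eq u∈cs a∈u)
    ; plug  = λ β up down βu → plug ctx β up
        (λ a βa → [ inj₁ , inj₂ ∘ ∨-child-var eq u∈cs ] (down a βa))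
        (∨-gate eq u u∈cs βu)
    }

  output-context : (d : True α output) → (∀ y → y ∈ cols d) → NodeContext d
  output-context d full = record
    { fresh = λ a _ a∉ _ → a∉ (full (col a))
    ; plug  = λ _ _ _ βo → βo
    }

  -- The context is that of the whole gate and not of `part`: another permutation at the same gate
  -- may come with a different part, and its context must still be narrowed to this one.
  record Landing (t : ℕ) (α : Assignment X) (v : Node) : Set where
    field
      {gate}    : Subset #nodes
      is-∧-gate : label v ≡ ∧-gate gate
      gateTrue  : TrueOn gate α
      context   : GateContext gate gateTrue
      part      : Subset #nodes
      part⊆gate : ∀ u → u ∈ part → u ∈ gate

    partTrue : TrueOn part α
    partTrue u u∈ = gateTrue u (part⊆gate u u∈)

    partCols : Subset n
    partCols = cols∈ part partTrue

    field
      balanced : Balanced t partCols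

  -- Descends as long as one child reads more than `n ∸ t` columns; otherwise `split` finds a
  -- balanced set of children. The descent cannot end at a literal, which reads at most one column,
  -- since 1 + t ≤ 3t ≤ n.
  land : ∀ {t} → 1 ≤ t → t + t + t ≤ n → ColumnInjective α →
    (d : True α v) → NodeContext d → n < ∣ cols d ∣ + t → ∃ (Landing t α)
  land {t = t} 1≤t 3t≤n inj (literal {l = pos a} _ _) _ big = contradiction
    (subst (λ k → n < k + t) (∣⁅x⁆∣≡1 (col a)) big)
    (≤⇒≯ (≤-trans (+-mono-≤ (m≤n⇒m≤n+o t 1≤t) (≤-refl {t})) 3t≤n))
  land {t = t} 1≤t 3t≤n inj (literal {l = neg a} _ _) _ big = contradiction
    (subst (λ k → n < k + t) (∣⊥∣≡0 n) big)
    (≤⇒≯ (≤-trans (m≤n+m t (t + t)) 3t≤n))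
  land 1≤t 3t≤n inj (∨-gate eq u u∈cs d) ctx big =
    land 1≤t 3t≤n inj d (∨-context eq u u∈cs d ctx) big
  land 1≤t 3t≤n inj (∧-gate {cs} eq ds) ctx big
    with split cs (λ u u∈cs → cols (ds u u∈cs)) 3t≤n big
  ... | inj₁ (S , S⊆cs , bal) = _ , record
    { is-∧-gate = eq ; gateTrue = ds ; context = ∧-context eq ds ctx
    ; part = S ; part⊆gate = S⊆cs ; balanced = bal }
  ... | inj₂ (u , u∈cs , large) =
    land 1≤t 3t≤n inj (ds u u∈cs) (at-child inj eq ds (∧-context eq ds ctx) u u∈cs) large


  -- Exchanging subderivations, and nodes against edges.

  -- `J` and `J′` may differ at first. A column in `J` but not in `J′` becomes empty, and this
  -- defect is what will force the two sets to agree.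
  exchange : Assignment X → Subset n → Assignment X → Subset n → Assignment X
  exchange α J α′ J′ a = (α a Bool.∧ does (col a ∈? ∁ J)) Bool.∨ (α′ a Bool.∧ does (col a ∈? J′))

  exchange⁻ : ∀ {J J′ a} → T (exchange α J α′ J′ a) → T (α a) × col a ∉ J ⊎ T (α′ a) × col a ∈ J′
  exchange⁻ {α = α} {α′ = α′} {J = J} {J′} {a} β
    with α a | col a ∈? ∁ J | α′ a | col a ∈? J′
  ... | true  | yes a∈∁J | _         | _       = inj₁ (_ , x∈∁p⇒x∉p a∈∁J)
  ... | true  | no _     | true | yes a∈J = inj₂ (_ , a∈J)
  ... | false | _        | true | yes a∈J = inj₂ (_ , a∈J)

  exchange⁺ˡ : ∀ {J J′ a} → T (α a) → col a ∉ J → T (exchange α J α′ J′ a)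
  exchange⁺ˡ {α = α} {J = J} {a = a} αa a∉J with α a | col a ∈? ∁ J
  ... | true | yes _   = _
  ... | true | no a∉∁J = contradiction (x∉p⇒x∈∁p a∉J) a∉∁J

  exchange⁺ʳ : ∀ {J J′ a} → T (α′ a) → col a ∈ J′ → T (exchange α J α′ J′ a)
  exchange⁺ʳ {α′ = α′} {α = α} {J = J} {J′} {a} αa a∈J with α a Bool.∧ does (col a ∈? ∁ J) | α′ a | col a ∈? J′
  ... | true  | _         | _      = _
  ... | false | true | yes _  = _
  ... | false | true | no a∉J = contradiction a∈J a∉J

  -- The subderivations `ds′` are plugged into the context of `ds`. They survive because their
  -- positive reads lie in `J′`, while atoms kept from `α` lie outside `J` and hence, by `fresh`, do
  -- not occur below `S`.
  exchange-satisfies : ColumnInjective α′ → (ds : TrueOn S α) (ds′ : TrueOn S α′) →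
    GateContext S ds → Satisfies (exchange α (cols∈ S ds) α′ (cols∈ S ds′))
  exchange-satisfies {α′} {S} {α} inj′ ds ds′ ctx = plug ctx (exchange α J α′ J′)
    (λ a αa a∉J → exchange⁺ˡ {α = α} {α′} {J} {J′} αa a∉J)
    (λ a βa → [ inj₁ ∘ proj₁ , inj₂ ∘ (λ (α′a , a∈J′) → var′ a α′a a∈J′) ] (exchange⁻ {α = α} {α′} {J} {J′} βa))
    (λ u u∈S → transfer (ds′ u u∈S)
      (λ a α′a a∈u → exchange⁺ʳ {α′ = α′} {α} {J} {J′} α′a (∈⋃⁺ _ u u∈S a∈u))
      (λ a a∈u βa → [ (λ (αa , a∉J) → contradiction (u , u∈S , a∈u) (fresh ctx a αa a∉J)) , proj₁ ]
        (exchange⁻ {α = α} {α′} {J} {J′} βa)))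
    where
    J J′ : Subset n
    J = cols∈ S ds
    J′ = cols∈ S ds′
    var′ : ∀ a → T (α′ a) → col a ∈ J′ → VarIn S a
    var′ a α′a a∈J′ with u , u∈S , a∈u ← ∈⋃⁻ _ a∈J′ = u , u∈S , cols⇒var inj′ (ds′ u u∈S) a α′a a∈u

  -- Every node other than the output is a child of some node, so the edges account for all nodes
  -- but one.
  #nodes≤1+size : #nodes ≤ suc size
  #nodes≤1+size = begin
    #nodes                              ≡⟨ ∣⊤∣≡n #nodes ⟨
    ∣ ⊤ {#nodes} ∣                      ≤⟨ p⊆q⇒∣p∣≤∣q∣ {p = ⊤} (λ {u} _ → covered u) ⟩
    ∣ ⁅ output ⁆ ∪ allChildren ∣        ≤⟨ ∣p∪q∣≤∣p∣+∣q∣ ⁅ output ⁆ allChildren ⟩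
    ∣ ⁅ output ⁆ ∣ + ∣ allChildren ∣    ≤⟨ +-mono-≤ (≤-reflexive (∣⁅x⁆∣≡1 output)) (∣⋃[⊤]∣≤sum children) ⟩
    suc size                            ∎
    where
    open ≤-Reasoning
    allChildren : Subset #nodes
    allChildren = ⋃[ ⊤ ] λ v _ → children v
    covered : ∀ u → u ∈ ⁅ output ⁆ ∪ allChildren
    covered u with u ∈? allChildren
    ... | yes u∈ = x∈p∪q⁺ (inj₂ u∈)
    ... | no  u∉ with refl ← Equivalence.to (unique-output u) (λ v u∈v → u∉ (∈⋃⁺ _ v ∈⊤ u∈v))
      = x∈p∪q⁺ (inj₁ (x∈⁅x⁆ output))

-- The sentence and the permutation matrices among its models.

binary : Vocabulary
binary = record { #predicates = 1 ; arity = λ _ → 2 }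

-- With x for variable `zero` and y for the other one: (∀x ∃y R(x,y)) ∧ (∀y ∃x R(x,y)).
noEmptyRowOrColumn : FO² binary
noEmptyRowOrColumn =
  all zero (ex (suc zero) (atom zero ((zero , here) ∷ (suc zero , there here) ∷ []))) ∧
  all (suc zero) (ex zero (atom zero ((zero , here) ∷ (suc zero , there here) ∷ [])))

module PermutationMatrices {n : ℕ} {Δ : Set} (Δ-fin : Fin n ↔ Δ) (C : DNNF (GroundAtom binary Δ))
                           (encodes : C Encodes grounding noEmptyRowOrColumn Δ-fin) where

  open Inverse Δ-fin using (to; from; strictlyInverseˡ; strictlyInverseʳ)

  Atom : Set
  Atom = GroundAtom binary Δ

  entry : Fin n → Fin n → Atom
  entry i j = zero ⟨ to i ∷ to j ∷ [] ⟩

  row col : Atom → Fin n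
  row (zero ⟨ x ∷ _ ∷ [] ⟩) = from x
  col (zero ⟨ _ ∷ y ∷ [] ⟩) = from y

  entry-row-col : ∀ a → entry (row a) (col a) ≡ a
  entry-row-col (zero ⟨ x ∷ y ∷ [] ⟩) =
    cong₂ (λ u v → zero ⟨ u ∷ v ∷ [] ⟩) (strictlyInverseˡ x) (strictlyInverseˡ y)

  open DNNF C
  open Derivations C col

  matrix : Permutation′ n → Assignment Atom
  matrix π a = isYes (π ⟨$⟩ʳ row a ≟ col a)

  matrix⁻ : ∀ π a → T (matrix π a) → π ⟨$⟩ʳ row a ≡ col a
  matrix⁻ π a = toWitness

  matrix-entry⁻ : ∀ π {i j} → T (matrix π (entry i j)) → π ⟨$⟩ʳ i ≡ j
  matrix-entry⁻ π {i} {j} t = trans (cong (π ⟨$⟩ʳ_) (sym (strictlyInverseʳ i)))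
    (trans (matrix⁻ π (entry i j) t) (strictlyInverseʳ j))

  matrix-entry⁺ : ∀ π i → T (matrix π (entry i (π ⟨$⟩ʳ i)))
  matrix-entry⁺ π i = fromWitness
    (trans (cong (π ⟨$⟩ʳ_) (strictlyInverseʳ i)) (sym (strictlyInverseʳ (π ⟨$⟩ʳ i))))

  matrix-injective : ∀ π → ColumnInjective (matrix π)
  matrix-injective π {a} {b} πa πb eq =
    trans (sym (entry-row-col a)) (trans (cong₂ entry rows eq) (entry-row-col b))
    where
    rows : row a ≡ row b
    rows = trans (sym (inverseˡ π))
      (trans (cong (π ⟨$⟩ˡ_) (trans (matrix⁻ π a πa) (trans eq (sym (matrix⁻ π b πb))))) (inverseˡ π))

  satisfies-matrix : ∀ π → Satisfies (matrix π)
  satisfies-matrix π = Equivalence.from (encodes (matrix π))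
    ( (λ i → π ⟨$⟩ʳ i , matrix-entry⁺ π i)
    , (λ j → π ⟨$⟩ˡ j , subst (λ k → T (matrix π (entry (π ⟨$⟩ˡ j) k))) (inverseʳ π) (matrix-entry⁺ π (π ⟨$⟩ˡ j))))

  rows-covered : ∀ {β} → Satisfies β → ∀ i → ∃ λ j → T (β (entry i j))
  rows-covered {β} sat = proj₁ (Equivalence.to (encodes β) sat)

  columns-covered : ∀ {β} → Satisfies β → ∀ j → ∃ λ i → T (β (entry i j))
  columns-covered {β} sat = proj₂ (Equivalence.to (encodes β) sat)

  -- Derivability survives in the submatrix of π on the columns of a derivation,
  -- which therefore still meets every column.
  all-columns : ∀ π (d : True (matrix π) output) y → y ∈ cols d
  all-columns π d y = subst (_∈ cols d) (strictlyInverseʳ y) (column-in (columns-covered satisfies-β y))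
    where
    β : Assignment Atom
    β a = matrix π a Bool.∧ isYes (col a ∈? cols d)
    β⁻ : ∀ a → T (β a) → T (matrix π a) × T (isYes (col a ∈? cols d))
    β⁻ a = Equivalence.to T-∧
    satisfies-β : Satisfies β
    satisfies-β = transfer d
      (λ a πa a∈ → Equivalence.from T-∧ (πa , fromWitness a∈))
      (λ a _ βa → proj₁ (β⁻ a βa))
    -- The column of an entry does not depend on its row, so `entry y y` stands for any entry of
    -- column `y`.
    column-in : (∃ λ i → T (β (entry i y))) → col (entry y y) ∈ cols d
    column-in (i , βiy) = toWitness (proj₂ (β⁻ (entry i y) βiy))

  lands : ∀ {t} → 1 ≤ t → t + t + t ≤ n → ∀ π → ∃ (Landing t (matrix π))
  lands {t} 1≤t 3t≤n π = land 1≤t 3t≤n (matrix-injective π) d (output-context d full) (begin-strict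
    n                     <⟨ m<m+n n 1≤t ⟩
    n + t                 ≡⟨ cong (_+ t) (∣⊤∣≡n n) ⟨
    ∣ ⊤ {n} ∣ + t         ≤⟨ +-monoˡ-≤ t (p⊆q⇒∣p∣≤∣q∣ {p = ⊤} (λ {y} _ → full y)) ⟩
    ∣ cols d ∣ + t        ∎)
    where
    open ≤-Reasoning
    d = satisfies-matrix π
    full = all-columns π d

  module Exchange (π ρ : Permutation′ n) {S : Subset #nodes}
         (ds : TrueOn S (matrix π)) (es : TrueOn S (matrix ρ)) (ctx : GateContext S ds) where

    exchanged : Satisfies (exchange (matrix π) (cols∈ S ds) (matrix ρ) (cols∈ S es))
    exchanged = exchange-satisfies (matrix-injective ρ) ds es ctx

    exchanged⁻ = λ a → exchange⁻ {matrix π} {matrix ρ} {cols∈ S ds} {cols∈ S es} {a}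

    -- Column `y` of the exchanged model is nonempty, and the entries of `π` in it were erased; what
    -- remains comes from `ρ`.
    cols-⊆ : ∀ {y} → y ∈ cols∈ S ds → y ∈ cols∈ S es
    cols-⊆ {y} y∈ with i , t ← columns-covered exchanged y with exchanged⁻ (entry i y) t
    ... | inj₁ (_ , y∉) = contradiction (subst (_∈ cols∈ S ds) (sym (strictlyInverseʳ y)) y∈) y∉
    ... | inj₂ (_ , y∈′) = subst (_∈ cols∈ S es) (strictlyInverseʳ y) y∈′

    -- The only entry of `π` in row `x` was erased, so the row is saved by the entry of `ρ`, which
    -- must lie in a column that was kept.
    rows-⊆ : ∀ x → π ⟨$⟩ʳ x ∈ cols∈ S ds → ρ ⟨$⟩ʳ x ∈ cols∈ S es
    rows-⊆ x πx∈ with j , t ← rows-covered exchanged x with exchanged⁻ (entry x j) t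
    ... | inj₁ (πxj , j∉) = contradiction
      (subst (_∈ cols∈ S ds) (trans (matrix-entry⁻ π πxj) (sym (strictlyInverseʳ j))) πx∈) j∉
    ... | inj₂ (ρxj , j∈) =
      subst (_∈ cols∈ S es) (trans (strictlyInverseʳ j) (sym (matrix-entry⁻ ρ ρxj))) j∈

  -- Few permutations share a gate.

  module _ {t : ℕ} where

    partRows : ∀ π {v} → Landing t (matrix π) v → Subset n
    partRows π L = tabulate λ x → lookup (Landing.partCols L) (π ⟨$⟩ʳ x)

    -- Both derivations are cut at the part chosen by `L`. Exchanging in both directions shows that
    -- they read the same columns there, and that `π` and `ρ` send the same rows into those columns.
    same-landing : ∀ π ρ {v} (L : Landing t (matrix π) v) → Landing t (matrix ρ) v →
      Preimage (partRows π L) (Landing.partCols L) ρ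
    same-landing π ρ L M x
      with refl ← trans (sym (Landing.is-∧-gate L)) (Landing.is-∧-gate M) =
      trans (lookup∘tabulate _ x) (⇔⇒≡
        (λ πx → []=⇒lookup (M⇒L.cols-⊆ (L⇒M.rows-⊆ x (lookup⇒[]= _ _ πx))))
        (λ ρx → []=⇒lookup (M⇒L.rows-⊆ x (L⇒M.cols-⊆ (lookup⇒[]= _ _ ρx)))))
      where
      module L = Landing L
      module M = Landing M
      ds = L.partTrue
      es : TrueOn L.part (matrix ρ)
      es u u∈ = M.gateTrue u (L.part⊆gate u u∈)
      ctxL : GateContext L.part ds
      ctxL = at-children (matrix-injective π) L.is-∧-gate L.gateTrue L.context L.part L.part⊆gate
      ctxM : GateContext L.part es
      ctxM = at-children (matrix-injective ρ) M.is-∧-gate M.gateTrue M.context L.part L.part⊆gate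
      module L⇒M = Exchange π ρ ds es ctxL
      module M⇒L = Exchange ρ π es ds ctxM
      ⇔⇒≡ : ∀ {b c} → (b ≡ true → c ≡ true) → (c ≡ true → b ≡ true) → b ≡ c
      ⇔⇒≡ {true}          f g = sym (f refl)
      ⇔⇒≡ {false} {true}  f g = g refl
      ⇔⇒≡ {false} {false} f g = refl

    Occupied : Node → Set
    Occupied v = ∃ λ π → Landing t (matrix π) v

    -- One landing at the gate serves as reference; by `same-landing` every permutation that lands
    -- there satisfies the resulting event.
    constraint : ∀ {v} → Dec (Occupied v) → Event n
    constraint (yes (π , L)) = preimage (partRows π L) (Landing.partCols L)
    constraint (no _) _      = false

    count-constraint : ∀ {v} (o : Dec (Occupied v)) → count (constraint o) * 2 ^ t ≤ n !
    count-constraint (yes (π , L)) = ≤-trans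
      (*-monoˡ-≤ (2 ^ t) (count-preimage (partRows π L) (Landing.partCols L)))
      (subst (_≤ n !) (*-comm (2 ^ t) _)
        (2^t*weight≤n! (Landing.partCols L) (proj₁ (Landing.balanced L)) (proj₂ (Landing.balanced L))))
    count-constraint (no _) = subst (λ k → k * 2 ^ t ≤ n !) (sym (count-∅ {n} {λ _ → false} λ _ → refl)) z≤n

    2^t≤#nodes : 1 ≤ t → t + t + t ≤ n → 2 ^ t ≤ #nodes
    2^t≤#nodes 1≤t 3t≤n = decidable-stable (2 ^ t ≤? #nodes) λ 2^t≰ →
      -- Whether a node is occupied is not decided constructively. The goal is a decidable
      -- inequality, so excluded middle may be assumed under double negation for the finitely many
      -- nodes.
      sequence (RawMonad.rawApplicative ¬¬-Monad) (λ v → ¬¬-excluded-middle) λ occupied? →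
        refute occupied? (≰⇒> 2^t≰)
      where
      open ≤-Reasoning
      refute : (∀ v → Dec (Occupied v)) → ¬ (#nodes < 2 ^ t)
      refute occupied? few
        -- With fewer than 2^t nodes the constraints together count fewer than n! permutations. The
        -- permutation that escapes them all must still land at some node, which is absurd.
        with π , avoids ← avoid (λ v → constraint (occupied? v))
               (*-cancelʳ-< (2 ^ t) _ _ (begin-strict
                 sum (λ v → count (constraint (occupied? v))) * 2 ^ t   ≡⟨ sum-*ʳ (λ v → count (constraint (occupied? v))) (2 ^ t) ⟨
                 sum (λ v → count (constraint (occupied? v)) * 2 ^ t)   ≤⟨ sum≤* (λ v → count-constraint (occupied? v)) ⟩
                 #nodes * n !                                           <⟨ *-monoˡ-< (n !) {{n !≢0}} few ⟩
                 2 ^ t * n !                                            ≡⟨ *-comm (2 ^ t) (n !) ⟩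
                 n ! * 2 ^ t                                            ∎))
        with v , M ← lands 1≤t 3t≤n π
        with occupied? v | avoids v
      ... | no ¬occ     | _   = ¬occ (π , M)
      ... | yes (ρ , L) | eq  = contradiction
        (trans (sym eq) (dec-true (preimage? (partRows ρ L) (Landing.partCols L) π) (same-landing ρ π L M))) λ ()

-- Arithmetic of the exponent.

-- From n ≥ 6 follows t ≥ 2, which covers the remainder of n modulo 3 and gives n ≤ 4t. It also
-- gives s ≥ 2, so that s + 1 ≤ s² absorbs the extra node.
2^n≤s^8 : ∀ {n s} → 6 ≤ n → 2 ^ (n / 3) ≤ suc s → 2 ^ (1 * n) ≤ s ^ 8
2^n≤s^8 {n} {s} 6≤n 2^t≤1+s = begin
  2 ^ (1 * n)     ≡⟨ cong (2 ^_) (*-identityˡ n) ⟩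
  2 ^ n           ≤⟨ ^-monoʳ-≤ 2 n≤t*4 ⟩
  2 ^ (t * 4)     ≡⟨ ^-*-assoc 2 t 4 ⟨
  (2 ^ t) ^ 4     ≤⟨ ^-monoˡ-≤ 4 (≤-trans 2^t≤1+s 1+s≤s^2) ⟩
  (s ^ 2) ^ 4     ≡⟨ ^-*-assoc s 2 4 ⟩
  s ^ 8           ∎
  where
  open ≤-Reasoning
  t = n / 3
  2≤t : 2 ≤ t
  2≤t = /-mono-≤ 6≤n (≤-refl {3})
  n≤t*4 : n ≤ t * 4
  n≤t*4 = begin
    n                ≡⟨ m≡m%n+[m/n]*n n 3 ⟩
    n % 3 + t * 3    ≤⟨ +-monoˡ-≤ (t * 3) (≤-trans (s≤s⁻¹ (m%n<n n 3)) 2≤t) ⟩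
    t + t * 3        ≡⟨ *-suc t 3 ⟨
    t * 4            ∎
  2≤s : 2 ≤ s
  2≤s = s≤s⁻¹ (≤-trans (≤-trans (n≤1+n 3) (^-monoʳ-≤ 2 2≤t)) 2^t≤1+s)
  1+s≤s^2 : suc s ≤ s ^ 2
  1+s≤s^2 = begin
    1 + s        ≤⟨ +-monoˡ-≤ s (<⇒≤ 2≤s) ⟩
    s + s        ≡⟨ cong (s +_) (+-identityʳ s) ⟨
    2 * s        ≤⟨ *-monoˡ-≤ s 2≤s ⟩
    s * s        ≡⟨ cong (s *_) (*-identityʳ s) ⟨
    s ^ 2        ∎

theorem2 : ∃ λ (σ : Vocabulary) → ∃ λ (Γ : FO² σ) →
    -- size ≥ 2^(c n) with c = p / q
    ∃ λ (p : ℕ) → ∃ λ (q : ℕ) → ∃ λ (n₀ : ℕ) →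
    1 ≤ p × 1 ≤ q ×
    ((n : ℕ) → 1 ≤ n → n₀ ≤ n →
    (Δ : Set) (Δ-fin : Fin n ↔ Δ) (C : DNNF (GroundAtom σ Δ)) →
    C Encodes grounding Γ Δ-fin →
    2 ^ (p * n) ≤ DNNF.size C ^ q)
-- Here c = 1/8, and n₀ = 6 is where n / 3 reaches 2.
theorem2 = binary , noEmptyRowOrColumn , 1 , 8 , 6 , ≤-refl , s≤s z≤n , bound
  where
  bound : (n : ℕ) → 1 ≤ n → 6 ≤ n → (Δ : Set) (Δ-fin : Fin n ↔ Δ) (C : DNNF (GroundAtom binary Δ)) →
    C Encodes grounding noEmptyRowOrColumn Δ-fin → 2 ^ (1 * n) ≤ DNNF.size C ^ 8
  bound n _ 6≤n Δ Δ-fin C encodes = 2^n≤s^8 6≤n (≤-trans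
    (2^t≤#nodes {n / 3} (≤-trans (n≤1+n 1) (/-mono-≤ 6≤n (≤-refl {3}))) 3t≤n)
    #nodes≤1+size)
    where
    open PermutationMatrices Δ-fin C encodes
    open Derivations C col using (#nodes≤1+size)
    open ≤-Reasoning
    t = n / 3
    3t≤n : t + t + t ≤ n
    3t≤n = begin
      t + t + t          ≡⟨ +-assoc t t t ⟩
      t + (t + t)        ≡⟨ cong (λ k → t + (t + k)) (+-identityʳ t) ⟨
      3 * t              ≡⟨ *-comm 3 t ⟩
      t * 3              ≤⟨ m/n*n≤m n 3 ⟩
      n                  ∎
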